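{- Let $s \ge 0$, $k \ge \ell \ge s+1$ and $n \ge k+\ell$ be integers. Let $\mathcal{F} \subseteq \binom{[n]}{k}$ and $\mathcal{G} \subseteq \binom{[n]}{\ell}$ be cross-intersecting families. Suppose that $\mathcal{G}$ is intersecting and $\binom{[\ell+s]}{\ell} \subseteq \mathcal{G}$. Then $$|\mathcal{F}|+|\mathcal{G}| \le \binom{\ell+s}{\ell}+\binom{n}{k}-\sum_{i=0}^{s}\binom{\ell+s}{i}\binom{n-\ell-s}{k-i}.$$
   Context: $[n]=\{1,2,\ldots,n\}$, and for a set $X$, $\binom{X}{k}$ denotes the family of all $k$-element subsets of $X$. Two families $\mathcal{F},\mathcal{G}\subseteq 2^{[n]}$ are cross-intersecting if $|F\cap G|\ge 1$ for all $F\in\mathcal{F}$ and $G\in\mathcal{G}$. A family $\mathcal{G}\subseteq 2^{[n]}$ is intersecting if $|G\cap G'|\ge 1$ for all $G,G'\in\mathcal{G}$. A binomial coefficient $\binom{a}{b}$ with integers $0\le a<b$ is $0$. -}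

module Defs where

open import Data.Fin.Base using (toℕ)
open import Data.Fin.Subset using (Subset; ∣_∣; _∩_; _⊆_)
open import Data.List.Base using (List; length; map; upTo)
open import Data.List.Membership.Propositional using (_∈_)
open import Data.List.Relation.Unary.Unique.Propositional using (Unique)
open import Data.Nat.Base using (ℕ; suc; _≤_; _<ᵇ_)
open import Data.Nat.ListAction using (sum)
open import Data.Product.Base using (_×_)
open import Data.Vec.Base using (tabulate)
open import Level using (0ℓ)
open import Relation.Binary.PropositionalEquality.Core using (_≡_)
open import Relation.Unary using (Pred)

-- A family of subsets of [n], given by a duplicate-free enumeration, so that
-- its cardinality is the length of the list. The ground set [n] = {1,…,n} is
-- Fin n, with element i of Fin n standing for toℕ i + 1.
record Family (n : ℕ) : Set where
  constructor family
  field
    members : List (Subset n)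
    unique  : Unique members

open Family public

⟦_⟧ : ∀ {n} → Family n → Pred (Subset n) 0ℓ
⟦ F ⟧ A = A ∈ members F

size : ∀ {n} → Family n → ℕ
size F = length (members F)

-- The initial segment {1,…,m} as a subset of [n]; it has m elements only when
-- m ≤ n, and is all of [n] otherwise.
segment : ∀ n → ℕ → Subset n
segment n m = tabulate λ i → toℕ i <ᵇ m

-- All k-element subsets of X.
_choose_ : ∀ {n} → Subset n → ℕ → Pred (Subset n) 0ℓ
(X choose k) A = A ⊆ X × ∣ A ∣ ≡ k

CrossIntersecting : ∀ {n} → Family n → Family n → Set
CrossIntersecting F G = ∀ {A B} → ⟦ F ⟧ A → ⟦ G ⟧ B → 1 ≤ ∣ A ∩ B ∣

Intersecting : ∀ {n} → Family n → Set
Intersecting G = ∀ {A B} → ⟦ G ⟧ A → ⟦ G ⟧ B → 1 ≤ ∣ A ∩ B ∣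

-- The sum of f i over 0 ≤ i ≤ s, both ends included.
∑[0‥_] : ℕ → (ℕ → ℕ) → ℕ
∑[0‥ s ] f = sum (map f (upTo (suc s)))

{-# OPTIONS --safe #-}

-- Write L = ℓ + s and n = L + m = k + ℓ + t. Since every ℓ-subset of [L] lies in
-- 𝒢, each member of ℱ and of 𝒢 has more than s elements in [L]. At most
-- C(L, ℓ) members of 𝒢 lie inside [L]; the others are injected into the
-- k-sets that have more than s elements in [L], each going to a set disjoint
-- from it, hence outside ℱ. To do so, cut the complement of A ∈ 𝒢 into its
-- parts X ⊆ [L] and Y ⊆ [n] ∖ [L], and remove t elements by moving X and Y down
-- their chains in the bracketing symmetric chain decompositions of the two
-- cubes. How the t steps are split between X and Y depends only on the two
-- chains, so that the move can be undone.
module Submission where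

open import Defs
open import Data.Bool.Properties using (not-involutive)
open import Data.Empty using (⊥-elim)
open import Data.Fin.Subset using (⊤)
open import Data.Fin.Subset using (Subset; inside; outside; ⊥; ∁; _∩_; ∣_∣)
  renaming (_⊆_ to _⊑_)
open import Data.Fin.Subset.Properties
open import Data.List.Base as List
  using (List; []; _∷_; map; length; filter; concat; upTo; cartesianProductWith)
open import Data.List.Membership.Propositional using (_∈_)
open import Data.List.Membership.Propositional.Properties
open import Data.List.Properties
  using (length-map; length-++; length-++-sucʳ; map-∘; map-id-local; map-cong)
open import Data.List.Relation.Unary.All using (tabulate; _∷_)
import Data.List.Relation.Unary.All as All
import Data.List.Relation.Unary.All.Properties as All
open import Data.List.Relation.Unary.AllPairs using ([]; _∷_)
import Data.List.Relation.Unary.AllPairs as AllPairs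
import Data.List.Relation.Unary.AllPairs.Properties as AllPairs
open import Data.List.Relation.Unary.Any using (here; there)
open import Data.List.Relation.Unary.Unique.Propositional using (Unique)
import Data.List.Relation.Unary.Unique.Propositional.Properties as Unique
open import Data.List.Relation.Binary.Disjoint.Propositional using (Disjoint)
open import Data.Nat.Base using (ℕ; _+_; _*_; _∸_; _≤_)
open import Data.Nat.Base using (zero; suc; pred; _<_; _⊓_; z≤n; s≤s)
open import Data.Nat.Combinatorics using (_C_)
open import Data.Nat.Combinatorics using (nCk+nC[k+1]≡[n+1]C[k+1])
open import Data.Nat.ListAction using (sum)
open import Data.Nat.Properties
open import Data.Nat.Tactic.RingSolver using (solve-∀)
open import Data.Product.Base using (∃; _×_; _,_; proj₁; proj₂)
open import Data.Sum.Base using (inj₁; inj₂; [_,_]′)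
open import Data.Vec.Base as Vec using ([]; _∷_; _++_; take; drop)
open import Data.Vec.Properties
  using (take++drop≡id; take-map; ++-injectiveˡ; ++-injectiveʳ)
import Data.Vec.Properties as Vec
open import Function.Base using (_∘_)
open import Relation.Binary.PropositionalEquality
open import Relation.Nullary using (yes; no)
open import Relation.Unary using (_⊆_)
open import Relation.Unary using (Pred; Decidable)
open import Relation.Unary.Properties using (∁?)

private variable
  n m b : ℕ

-- Symmetric chains in the cube.

-- Read p as a bracket word, elements opening and non-elements closing, in the order
-- of the indices. Then removable and addable count the unmatched opening and closing
-- brackets, and bottom the matched pairs. The sets with given matched pairs form a
-- symmetric chain, traversed by down (which drops the first unmatched element) and up.
addable : Subset n → ℕ
addable []            = 0
addable (outside ∷ p) = suc (addable p)
addable (inside  ∷ p) = pred (addable p)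

removable : Subset n → ℕ
removable []            = 0
removable (outside ∷ p) = removable p
removable (inside  ∷ p) with addable p
... | zero  = suc (removable p)
... | suc _ = removable p

bottom : Subset n → ℕ
bottom []            = 0
bottom (outside ∷ p) = bottom p
bottom (inside  ∷ p) with addable p
... | zero  = bottom p
... | suc _ = suc (bottom p)

down : Subset n → Subset n
down []            = []
down (outside ∷ p) = outside ∷ down p
down (inside  ∷ p) with addable p
... | zero  = outside ∷ p
... | suc _ = inside ∷ down p

up : Subset n → Subset n
up []            = []
up (inside  ∷ p) = inside ∷ up p
up (outside ∷ p) with addable p
... | zero  = inside ∷ p
... | suc _ = outside ∷ up p

∣p∣≡bottom+removable : (p : Subset n) → ∣ p ∣ ≡ bottom p + removable p
∣p∣≡bottom+removable []            = refl
∣p∣≡bottom+removable (outside ∷ p) = ∣p∣≡bottom+removable p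
∣p∣≡bottom+removable (inside  ∷ p) with addable p
... | zero  = trans (cong suc (∣p∣≡bottom+removable p)) (sym (+-suc (bottom p) _))
... | suc _ = cong suc (∣p∣≡bottom+removable p)

-- The size counts the opening brackets, `bottom` the matched closing ones and `addable` the
-- unmatched closing ones.
∣p∣+bottom+addable≡n : (p : Subset n) → ∣ p ∣ + bottom p + addable p ≡ n
∣p∣+bottom+addable≡n []            = refl
∣p∣+bottom+addable≡n (outside ∷ p) =
  trans (+-suc (∣ p ∣ + bottom p) _) (cong suc (∣p∣+bottom+addable≡n p))
∣p∣+bottom+addable≡n (inside  ∷ p) with addable p | ∣p∣+bottom+addable≡n p
... | zero  | eq = cong suc eq
... | suc a | eq = cong suc (begin
  ∣ p ∣ + suc (bottom p) + a  ≡⟨ cong (_+ a) (+-suc ∣ p ∣ _) ⟩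
  suc (∣ p ∣ + bottom p + a)  ≡⟨ +-suc (∣ p ∣ + bottom p) a ⟨
  ∣ p ∣ + bottom p + suc a    ≡⟨ eq ⟩
  _                           ∎)
  where open ≡-Reasoning

-- Chains are symmetric: the one through p ends at size n minus `bottom p`.
∣p∣+bottom≤n : (p : Subset n) → ∣ p ∣ + bottom p ≤ n
∣p∣+bottom≤n p = m+n≤o⇒m≤o _ (≤-reflexive (∣p∣+bottom+addable≡n p))

-- To the left of the first unmatched opening bracket stand only matched pairs and unmatched closing
-- brackets. Turned around, it finds no partner there and becomes one more unmatched closing
-- bracket, while all pairs stay.
addable-down : (p : Subset n) → removable p ≡ suc b → addable (down p) ≡ suc (addable p)
addable-down (outside ∷ p) r = cong suc (addable-down p r)
addable-down (inside  ∷ p) r with addable p in eq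
... | zero  = cong suc eq
... | suc a = trans (cong pred (addable-down p r)) eq

removable-down : (p : Subset n) → removable p ≡ suc b → removable (down p) ≡ b
removable-down (outside ∷ p) r = removable-down p r
removable-down (inside  ∷ p) r with addable p in eq
... | zero  = suc-injective r
... | suc a rewrite addable-down p r = removable-down p r

bottom-down : (p : Subset n) → removable p ≡ suc b → bottom (down p) ≡ bottom p
bottom-down (outside ∷ p) r = bottom-down p r
bottom-down (inside  ∷ p) r with addable p in eq
... | zero  = refl
... | suc a rewrite addable-down p r = cong suc (bottom-down p r)

∣down∣ : (p : Subset n) → removable p ≡ suc b → suc ∣ down p ∣ ≡ ∣ p ∣
∣down∣ (outside ∷ p) r = ∣down∣ p r
∣down∣ (inside  ∷ p) r with addable p
... | zero  = refl
... | suc a = cong suc (∣down∣ p r)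

-- The bracket closed by `down` is the last unmatched closing one of the new word, and that is the
-- bracket which `up` opens.
up-down : (p : Subset n) → removable p ≡ suc b → up (down p) ≡ p
up-down (outside ∷ p) r rewrite addable-down p r = cong (outside ∷_) (up-down p r)
up-down (inside  ∷ p) r with addable p in eq
... | zero  rewrite eq = refl
... | suc a = cong (inside ∷_) (up-down p r)

down-⊆ : (p : Subset n) → down p ⊑ p
down-⊆ []            = λ ()
down-⊆ (outside ∷ p) = s⊆s (down-⊆ p)
down-⊆ (inside  ∷ p) with addable p
... | zero  = out⊆ ⊆-refl
... | suc a = s⊆s (down-⊆ p)

lower : ℕ → Subset n → Subset n
lower zero    p = p
lower (suc d) p = lower d (down p)

-- The outermost `up` undoes the first `down` of `lower`, so that `raise-lower` is a plain
-- induction.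
raise : ℕ → Subset n → Subset n
raise zero    p = p
raise (suc d) p = up (raise d p)

lower-⊆ : ∀ d (p : Subset n) → lower d p ⊑ p
lower-⊆ zero    p = ⊆-refl
lower-⊆ (suc d) p = ⊆-trans (lower-⊆ d (down p)) (down-⊆ p)

module _ where
  private
    step : ∀ {d} {p : Subset n} → suc d ≤ removable p →
           ∃ λ b → removable p ≡ suc b × d ≤ removable (down p)
    step {p = p} d<r with removable p in eq
    step {p = p} (s≤s d≤b) | suc b = b , refl , subst (_ ≤_) (sym (removable-down p eq)) d≤b

  -- Every step stays on the chain, so a quantity computed from `bottom` alone can be recovered from
  -- the lowered set.
  bottom-lower : ∀ d (p : Subset n) → d ≤ removable p → bottom (lower d p) ≡ bottom p
  bottom-lower zero    p _   = refl
  bottom-lower (suc d) p d<r with _ , eq , d≤ ← step {p = p} d<r =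
    trans (bottom-lower d (down p) d≤) (bottom-down p eq)

  ∣lower∣ : ∀ d (p : Subset n) → d ≤ removable p → ∣ lower d p ∣ + d ≡ ∣ p ∣
  ∣lower∣ zero    p _   = +-identityʳ _
  ∣lower∣ (suc d) p d<r with _ , eq , d≤ ← step {p = p} d<r =
    trans (+-suc _ d) (trans (cong suc (∣lower∣ d (down p) d≤)) (∣down∣ p eq))

  raise-lower : ∀ d (p : Subset n) → d ≤ removable p → raise d (lower d p) ≡ p
  raise-lower zero    p _   = refl
  raise-lower (suc d) p d<r with _ , eq , d≤ ← step {p = p} d<r =
    trans (cong up (raise-lower d (down p) d≤)) (up-down p eq)

-- Dividing t steps between two chains.

-- How many of the t steps are made in X. Here x and y are the least sizes on the two
-- chains, no X that occurs is larger than pred ℓ ⊓ (ℓ + s ∸ x), and at least y of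
-- the k remaining elements have to stay in Y.
shift : (k ℓ s t x y : ℕ) → ℕ
shift k ℓ s t x y = t ⊓ ((pred ℓ ⊓ (ℓ + s ∸ x)) + y ∸ k)

-- Here u and v are the sizes of X and Y, and bx and by the numbers of steps down available to them.
module Shift {k ℓ s t m x bx y by u v : ℕ}
  (ℓ≤k : ℓ ≤ k) (s+m≡k+t : s + m ≡ k + t)
  (u≡ : u ≡ x + bx) (v≡ : v ≡ y + by)
  (u+x≤ : u + x ≤ ℓ + s) (v+y≤ : v + y ≤ m) (u+v≡ : u + v ≡ k + t)
  (s<u : s < u) (u<ℓ : u < ℓ) where

  private
    -- Y has at most m minus y elements, and u + v equals s + m, so X holds the rest.
    s+y≤u : s + y ≤ u
    s+y≤u = +-cancelʳ-≤ v _ _ (begin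
      s + y + v    ≡⟨ +-assoc s y v ⟩
      s + (y + v)  ≡⟨ cong (s +_) (+-comm y v) ⟩
      s + (v + y)  ≤⟨ +-monoʳ-≤ s v+y≤ ⟩
      s + m        ≡⟨ s+m≡k+t ⟩
      k + t        ≡⟨ u+v≡ ⟨
      u + v        ∎)
      where open ≤-Reasoning

    excess : ℕ
    excess = (pred ℓ ⊓ (ℓ + s ∸ x)) + y ∸ k

    -- The steps that Y cannot take number u + y minus k, and `excess` replaces u by an upper bound
    -- that depends only on x.
    t≤by+excess : t ≤ by + excess
    t≤by+excess = +-cancelˡ-≤ k _ _ (begin
      k + t                    ≡⟨ u+v≡ ⟨
      u + v                    ≡⟨ cong (u +_) v≡ ⟩
      u + (y + by)             ≡⟨ +-assoc u y by ⟨
      u + y + by               ≤⟨ +-monoˡ-≤ by (+-monoˡ-≤ y (⊓-glb (<⇒≤pred u<ℓ) (m+n≤o⇒m≤o∸n u u+x≤))) ⟩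
      w + by                   ≤⟨ +-monoˡ-≤ by (m≤n+m∸n w k) ⟩
      k + excess + by          ≡⟨ +-assoc k excess by ⟩
      k + (excess + by)        ≡⟨ cong (k +_) (+-comm excess by) ⟩
      k + (by + excess)        ∎)
      where
      open ≤-Reasoning
      w = (pred ℓ ⊓ (ℓ + s ∸ x)) + y

  shift≤t : shift k ℓ s t x y ≤ t
  shift≤t = m⊓n≤m t _

  t∸shift≤by : t ∸ shift k ℓ s t x y ≤ by
  t∸shift≤by = m≤n+o⇒m∸n≤o t (shift k ℓ s t x y) (begin
    t                            ≤⟨ ⊓-glb (m≤n+m t by) t≤by+excess ⟩
    (by + t) ⊓ (by + excess)     ≡⟨ +-distribˡ-⊓ by t excess ⟨
    by + shift k ℓ s t x y       ≡⟨ +-comm by _ ⟩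
    shift k ℓ s t x y + by       ∎)
    where open ≤-Reasoning

  -- Of the two bounds on u, this uses ℓ + s ∸ x, the top of the chain of X, together with ℓ ≤ k and
  -- s + y ≤ u.
  shift≤bx : shift k ℓ s t x y ≤ bx
  shift≤bx = ≤-trans (m⊓n≤n t _) (m≤n+o⇒m∸n≤o _ k (+-cancelˡ-≤ x _ _ (begin
    x + ((pred ℓ ⊓ (ℓ + s ∸ x)) + y)  ≤⟨ +-monoʳ-≤ x (+-monoˡ-≤ y (m⊓n≤n (pred ℓ) _)) ⟩
    x + ((ℓ + s ∸ x) + y)             ≡⟨ +-assoc x _ y ⟨
    x + (ℓ + s ∸ x) + y               ≡⟨ cong (_+ y) (m+[n∸m]≡n (m+n≤o⇒n≤o u u+x≤)) ⟩
    ℓ + s + y                         ≡⟨ +-assoc ℓ s y ⟩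
    ℓ + (s + y)                       ≤⟨ +-mono-≤ ℓ≤k s+y≤u ⟩
    k + u                             ≡⟨ cong (k +_) u≡ ⟩
    k + (x + bx)                      ≡⟨ +-assoc k x bx ⟨
    k + x + bx                        ≡⟨ cong (_+ bx) (+-comm k x) ⟩
    x + k + bx                        ≡⟨ +-assoc x k bx ⟩
    x + (k + bx)                      ∎)))
    where open ≤-Reasoning

  -- Lowering must leave more than s elements in X. The bound `pred ℓ` on u serves this: with ℓ ≤ k
  -- it keeps `excess` at most `pred y`, while u is at least s + y.
  s+shift<u : s + shift k ℓ s t x y < u
  s+shift<u = ≤-<-trans (+-monoʳ-≤ s (≤-trans (m⊓n≤n t _) excess≤)) (s+pred<u y s+y≤u)
    where
    open ≤-Reasoning
    excess≤ : excess ≤ pred y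
    excess≤ = begin
      excess             ≤⟨ ∸-monoˡ-≤ k (+-monoˡ-≤ y (m⊓n≤m (pred ℓ) _)) ⟩
      pred ℓ + y ∸ k     ≤⟨ ∸-monoʳ-≤ (pred ℓ + y) ℓ≤k ⟩
      pred ℓ + y ∸ ℓ     ≡⟨ pred+∸ (≤-<-trans z≤n u<ℓ) ⟩
      pred y             ∎
      where
      pred+∸ : ∀ {a} → 0 < a → pred a + y ∸ a ≡ pred y
      pred+∸ {suc a} _ = trans (sym (pred[m∸n]≡m∸[1+n] (a + y) a)) (cong pred (m+n∸m≡n a y))
    s+pred<u : ∀ c → s + c ≤ u → s + pred c < u
    -- For y = 0 the predecessor gains nothing, and strictness comes from s < u.
    s+pred<u zero    _  = subst (_< u) (sym (+-identityʳ s)) s<u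
    s+pred<u (suc c) le = subst (_≤ u) (+-suc s c) le

-- Sizes, inclusions and complements of split subsets.

∣++∣ : (p : Subset n) (q : Subset m) → ∣ p ++ q ∣ ≡ ∣ p ∣ + ∣ q ∣
∣++∣ []            q = refl
∣++∣ (outside ∷ p) q = ∣++∣ p q
∣++∣ (inside  ∷ p) q = cong suc (∣++∣ p q)

∣take∣+∣drop∣ : ∀ n (p : Subset (n + m)) → ∣ take n p ∣ + ∣ drop n p ∣ ≡ ∣ p ∣
∣take∣+∣drop∣ n p = trans (sym (∣++∣ (take n p) _)) (cong ∣_∣ (take++drop≡id n p))

take-++ : (p : Subset n) (q : Subset m) → take n (p ++ q) ≡ p
take-++ {n} p q = ++-injectiveˡ _ p (take++drop≡id n (p ++ q))

drop-++ : (p : Subset n) (q : Subset m) → drop n (p ++ q) ≡ q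
drop-++ {n} p q = ++-injectiveʳ _ p (take++drop≡id n (p ++ q))

++-⊑ : {p p′ : Subset n} {q q′ : Subset m} → p ⊑ p′ → q ⊑ q′ → p ++ q ⊑ p′ ++ q′
++-⊑ {p = []}          {[]}          _  q⊑ = q⊑
++-⊑ {p = outside ∷ p} {_ ∷ p′}      p⊑ q⊑ = out⊆ (++-⊑ (drop-∷-⊆ p⊑) q⊑)
++-⊑ {p = inside ∷ p}  {outside ∷ _} p⊑ q⊑ with () ← p⊑ Vec.here
++-⊑ {p = inside ∷ p}  {inside ∷ p′} p⊑ q⊑ = s⊆s (++-⊑ (drop-∷-⊆ p⊑) q⊑)

∣p∣+∣∁p∣≡n : (p : Subset n) → ∣ p ∣ + ∣ ∁ p ∣ ≡ n
∣p∣+∣∁p∣≡n p = trans (cong (∣ p ∣ +_) (∣∁p∣≡n∸∣p∣ p)) (m+[n∸m]≡n (∣p∣≤n p))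

∁-involutive : (p : Subset n) → ∁ (∁ p) ≡ p
∁-involutive p = trans (sym (Vec.map-∘ _ _ p)) (trans (Vec.map-cong not-involutive p) (Vec.map-id p))

q⊑∁p⇒∣p∩q∣≡0 : (p : Subset n) {q : Subset n} → q ⊑ ∁ p → ∣ p ∩ q ∣ ≡ 0
q⊑∁p⇒∣p∩q∣≡0 {n} p {q} q⊑∁p = trans (cong ∣_∣ (Empty-unique λ (i , i∈p∩q) →
  let i∈p , i∈q = x∈p∩q⁻ p q i∈p∩q in x∈∁p⇒x∉p (q⊑∁p i∈q) i∈p)) (∣⊥∣≡0 n)

∣p∣≡0⇒p≡⊥ : (p : Subset n) → ∣ p ∣ ≡ 0 → p ≡ ⊥
∣p∣≡0⇒p≡⊥ []            _ = refl
∣p∣≡0⇒p≡⊥ (outside ∷ p) e = cong (outside ∷_) (∣p∣≡0⇒p≡⊥ p e)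

∃⊑-of-size : ∀ k (p : Subset n) → k ≤ ∣ p ∣ → ∃ λ q → q ⊑ p × ∣ q ∣ ≡ k
∃⊑-of-size zero    []            _         = [] , ⊆-refl , refl
∃⊑-of-size k       (outside ∷ p) k≤        = let q , q⊑ , e = ∃⊑-of-size k p k≤ in outside ∷ q , s⊆s q⊑ , e
∃⊑-of-size zero    (inside ∷ p)  _         = let q , q⊑ , e = ∃⊑-of-size 0 p z≤n in outside ∷ q , out⊆ q⊑ , e
∃⊑-of-size (suc k) (inside ∷ p)  (s≤s k≤)  = let q , q⊑ , e = ∃⊑-of-size k p k≤ in inside ∷ q , s⊆s q⊑ , cong suc e

-- Counting with duplicate-free lists.

module _ {a} {A : Set a} where

  Unique∧⊆⇒length≤ : ∀ {xs ys : List A} → Unique xs → (∀ {x} → x ∈ xs → x ∈ ys) →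
                     length xs ≤ length ys
  Unique∧⊆⇒length≤ {[]}     _           _     = z≤n
  Unique∧⊆⇒length≤ {x ∷ xs} (x∉ ∷ xs!) xs⊆ys with ys₁ , ys₂ , refl ← ∈-∃++ (xs⊆ys (here refl)) =
    subst (suc (length xs) ≤_) (sym (length-++-sucʳ ys₁ x ys₂)) (s≤s (Unique∧⊆⇒length≤ xs! without-x))
    where
    without-x : ∀ {y} → y ∈ xs → y ∈ ys₁ List.++ ys₂
    without-x y∈xs with ∈-++⁻ ys₁ (xs⊆ys (there y∈xs))
    ... | inj₁ y∈ys₁         = ∈-++⁺ˡ y∈ys₁
    ... | inj₂ (here refl)   = ⊥-elim (All.lookup x∉ y∈xs refl)
    ... | inj₂ (there y∈ys₂) = ∈-++⁺ʳ ys₁ y∈ys₂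

  length-filter+∁ : ∀ {p} {P : Pred A p} (P? : Decidable P) xs →
                    length (filter P? xs) + length (filter (∁? P?) xs) ≡ length xs
  length-filter+∁ P? []       = refl
  length-filter+∁ P? (x ∷ xs) with P? x
  ... | yes _ = cong suc (length-filter+∁ P? xs)
  ... | no  _ = trans (+-suc _ _) (cong suc (length-filter+∁ P? xs))

  length-concat-map : ∀ {b} {B : Set b} (f : B → List A) xs →
                      length (concat (map f xs)) ≡ sum (map (length ∘ f) xs)
  length-concat-map f []       = refl
  length-concat-map f (x ∷ xs) = trans (length-++ (f x)) (cong (_ +_) (length-concat-map f xs))

  length-cartesianProductWith : ∀ {b c} {B : Set b} {C : Set c} (f : A → B → C) xs ys →
                                length (cartesianProductWith f xs ys) ≡ length xs * length ys
  length-cartesianProductWith f []       ys = refl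
  length-cartesianProductWith f (x ∷ xs) ys = trans (length-++ (map (f x) ys))
    (cong₂ _+_ (length-map (f x) ys) (length-cartesianProductWith f xs ys))

  -- A left inverse on the elements of xs is enough: `map g` sends `map f xs` back to xs, and a
  -- repetition would survive it.
  map-unique : ∀ {b} {B : Set b} (f : A → B) (g : B → A) {xs} →
               (∀ {x} → x ∈ xs → g (f x) ≡ x) → Unique xs → Unique (map f xs)
  map-unique f g {xs} gf≗id xs! =
    Unique.map⁻ {f = g} (subst Unique (sym (trans (sym (map-∘ xs)) (map-id-local (tabulate gf≗id)))) xs!)

-- Enumerating k-sets, also by their number of elements in [L].

choices : ∀ n (k : ℕ) → List (Subset n)
choices n       zero    = ⊥ ∷ []
choices zero    (suc k) = []
choices (suc n) (suc k) = map (inside ∷_) (choices n k) List.++ map (outside ∷_) (choices n (suc k))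

length-choices : ∀ n k → length (choices n k) ≡ n C k
length-choices n       zero    = refl
length-choices zero    (suc k) = refl
length-choices (suc n) (suc k) = begin
  length (choices (suc n) (suc k))                    ≡⟨ length-++ (map _ (choices n k)) ⟩
  _                                                   ≡⟨ cong₂ _+_ (length-map _ (choices n k))
                                                                (length-map _ (choices n (suc k))) ⟩
  length (choices n k) + length (choices n (suc k))   ≡⟨ cong₂ _+_ (length-choices n k) (length-choices n (suc k)) ⟩
  n C k + n C suc k                                   ≡⟨ nCk+nC[k+1]≡[n+1]C[k+1] n k ⟩
  suc n C suc k                                       ∎
  where open ≡-Reasoning

choices-unique : ∀ n k → Unique (choices n k)
choices-unique n       zero    = All.[] ∷ []
choices-unique zero    (suc k) = []
choices-unique (suc n) (suc k) = Unique.++⁺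
  (Unique.map⁺ Vec.∷-injectiveʳ (choices-unique n k))
  (Unique.map⁺ Vec.∷-injectiveʳ (choices-unique n (suc k)))
  disjoint
  where
  disjoint : Disjoint (map (inside ∷_) (choices n k)) (map (outside ∷_) (choices n (suc k)))
  disjoint (p∈ , p∈′)
    with _ , _ , refl ← ∈-map⁻ (inside ∷_) p∈
    with () ← proj₂ (proj₂ (∈-map⁻ (outside ∷_) p∈′))

∈choices⇒∣p∣≡k : ∀ n k {p} → p ∈ choices n k → ∣ p ∣ ≡ k
∈choices⇒∣p∣≡k n       zero    (here refl) = ∣⊥∣≡0 n
∈choices⇒∣p∣≡k (suc n) (suc k) p∈ with ∈-++⁻ (map (inside ∷_) (choices n k)) p∈
... | inj₁ p∈ˡ with _ , q∈ , refl ← ∈-map⁻ (inside ∷_) p∈ˡ  = cong suc (∈choices⇒∣p∣≡k n k q∈)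
... | inj₂ p∈ʳ with _ , q∈ , refl ← ∈-map⁻ (outside ∷_) p∈ʳ = ∈choices⇒∣p∣≡k n (suc k) q∈

∣p∣≡k⇒∈choices : ∀ k (p : Subset n) → ∣ p ∣ ≡ k → p ∈ choices n k
∣p∣≡k⇒∈choices zero    p             e = here (∣p∣≡0⇒p≡⊥ p e)
∣p∣≡k⇒∈choices (suc k) (inside ∷ p)  e = ∈-++⁺ˡ (∈-map⁺ (inside ∷_) (∣p∣≡k⇒∈choices k p (suc-injective e)))
∣p∣≡k⇒∈choices (suc k) (outside ∷ p) e = ∈-++⁺ʳ _ (∈-map⁺ (outside ∷_) (∣p∣≡k⇒∈choices (suc k) p e))

length≤nCk : ∀ k {xs : List (Subset n)} → Unique xs → (∀ {p} → p ∈ xs → ∣ p ∣ ≡ k) →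
             length xs ≤ n C k
length≤nCk {n} k {xs} xs! sizes = subst (length xs ≤_) (length-choices n k)
  (Unique∧⊆⇒length≤ xs! λ p∈ → ∣p∣≡k⇒∈choices k _ (sizes p∈))

module _ (L m k : ℕ) where

  splitChoices : ℕ → List (Subset (L + m))
  splitChoices i = cartesianProductWith _++_ (choices L i) (choices m (k ∸ i))

  ∈splitChoices⇒∣take∣≡ : ∀ i {p} → p ∈ splitChoices i → ∣ take L p ∣ ≡ i
  ∈splitChoices⇒∣take∣≡ i p∈
    with q , r , q∈ , _ , refl ← ∈-cartesianProductWith⁻ _++_ (choices L i) (choices m (k ∸ i)) p∈ =
    trans (cong ∣_∣ (take-++ q r)) (∈choices⇒∣p∣≡k L i q∈)

  ∈splitChoices⇒∣p∣≡k : ∀ i {p} → i ≤ k → p ∈ splitChoices i → ∣ p ∣ ≡ k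
  ∈splitChoices⇒∣p∣≡k i i≤k p∈
    with q , r , q∈ , r∈ , refl ← ∈-cartesianProductWith⁻ _++_ (choices L i) (choices m (k ∸ i)) p∈ =
    trans (∣++∣ q r) (trans (cong₂ _+_ (∈choices⇒∣p∣≡k L i q∈) (∈choices⇒∣p∣≡k m (k ∸ i) r∈)) (m+[n∸m]≡n i≤k))

  -- For s ≤ k these are the k-sets with at most s elements among the first L; the sum subtracted in
  -- the theorem is their number.
  lowChoices : ℕ → List (Subset (L + m))
  lowChoices s = concat (map splitChoices (upTo (suc s)))

  ∈lowChoices⁻ : ∀ s {p} → p ∈ lowChoices s → ∃ λ i → i ≤ s × p ∈ splitChoices i
  ∈lowChoices⁻ s p∈
    with _ , p∈ps , ps∈ ← ∈-concat⁻′ _ p∈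
    with i , i∈ , refl ← ∈-map⁻ splitChoices ps∈ =
    i , <⇒≤pred (∈-upTo⁻ i∈) , p∈ps

  length-lowChoices : ∀ s → length (lowChoices s) ≡ ∑[0‥ s ] (λ i → (L C i) * (m C (k ∸ i)))
  length-lowChoices s = trans (length-concat-map splitChoices (upTo (suc s)))
    (cong sum (map-cong (λ i → trans (length-cartesianProductWith _++_ (choices L i) _)
      (cong₂ _*_ (length-choices L i) (length-choices m (k ∸ i)))) (upTo (suc s))))

  lowChoices-unique : ∀ s → Unique (lowChoices s)
  lowChoices-unique s = Unique.concat⁺
    (All.map⁺ (All.universal (λ i → Unique.cartesianProductWith⁺ _++_
      (λ {p} {p′} eq → ++-injectiveˡ p p′ eq , ++-injectiveʳ p p′ eq)
      (choices-unique L i) (choices-unique m (k ∸ i))) (upTo (suc s))))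
    (AllPairs.map⁺ (AllPairs.map disjoint (Unique.upTo⁺ (suc s))))
    where
    disjoint : ∀ {i j} → i ≢ j → Disjoint (splitChoices i) (splitChoices j)
    disjoint {i} {j} i≢j (p∈ , p∈′) =
      i≢j (trans (sym (∈splitChoices⇒∣take∣≡ i p∈)) (∈splitChoices⇒∣take∣≡ j p∈′))

-- Sets that meet every ℓ-subset of [ℓ + s].

tabulate-outside : ∀ n → Vec.tabulate {n = n} (λ _ → outside) ≡ ⊥
tabulate-outside zero    = refl
tabulate-outside (suc n) = cong (outside ∷_) (tabulate-outside n)

segment≡⊤++⊥ : ∀ L m → segment (L + m) L ≡ ⊤ {L} ++ ⊥ {m}
segment≡⊤++⊥ zero    m = tabulate-outside m
segment≡⊤++⊥ (suc L) m = cong (inside ∷_) (segment≡⊤++⊥ L m)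

-- With at most s elements in [ℓ + s], p would miss at least ℓ elements of that segment, and any ℓ
-- of these form a set disjoint from p.
meets-all⇒s<∣take∣ : ∀ ℓ s (p : Subset (ℓ + s + m)) →
  (∀ {q} → (segment (ℓ + s + m) (ℓ + s) choose ℓ) q → 1 ≤ ∣ p ∩ q ∣) →
  s < ∣ take (ℓ + s) p ∣
meets-all⇒s<∣take∣ {m} ℓ s p meets = ≰⇒> λ ∣p₁∣≤s →
  let q , q⊑∁p₁ , ∣q∣≡ℓ = ∃⊑-of-size ℓ (∁ p₁) (ℓ≤∣∁p₁∣ ∣p₁∣≤s)
      q∈seg : q ++ ⊥ ⊑ segment (ℓ + s + m) (ℓ + s)
      q∈seg = subst (q ++ ⊥ ⊑_) (sym (segment≡⊤++⊥ (ℓ + s) m)) (++-⊑ {p = q} {q = ⊥} ⊆⊤ ⊆-refl)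
      ∣q++⊥∣≡ℓ : ∣ q ++ ⊥ {m} ∣ ≡ ℓ
      ∣q++⊥∣≡ℓ = trans (∣++∣ q ⊥) (trans (cong₂ _+_ ∣q∣≡ℓ (∣⊥∣≡0 m)) (+-identityʳ ℓ))
  in <⇒≢ (meets (q∈seg , ∣q++⊥∣≡ℓ)) (sym (q⊑∁p⇒∣p∩q∣≡0 p
       (subst (q ++ ⊥ ⊑_) ∁p₁++∁p₂≡∁p (++-⊑ {q = ⊥} q⊑∁p₁ ⊥⊆))))
  where
  p₁ = take (ℓ + s) p
  p₂ = drop (ℓ + s) p

  ∁p₁++∁p₂≡∁p : ∁ p₁ ++ ∁ p₂ ≡ ∁ p
  ∁p₁++∁p₂≡∁p = trans (sym (Vec.map-++ _ p₁ p₂)) (cong ∁ (take++drop≡id (ℓ + s) p))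

  ℓ≤∣∁p₁∣ : ∣ p₁ ∣ ≤ s → ℓ ≤ ∣ ∁ p₁ ∣
  ℓ≤∣∁p₁∣ ∣p₁∣≤s = +-cancelʳ-≤ s _ _ (begin
    ℓ + s              ≡⟨ ∣p∣+∣∁p∣≡n p₁ ⟨
    ∣ p₁ ∣ + ∣ ∁ p₁ ∣  ≤⟨ +-monoˡ-≤ _ ∣p₁∣≤s ⟩
    s + ∣ ∁ p₁ ∣       ≡⟨ +-comm s _ ⟩
    ∣ ∁ p₁ ∣ + s       ∎)
    where open ≤-Reasoning

-- Lowering both parts of a set, and the inverse.

module Matching (k ℓ s t m : ℕ) (ℓ≤k : ℓ ≤ k) (s+m≡k+t : s + m ≡ k + t) where

  private
    L : ℕ
    L = ℓ + s

    δ : Subset L → Subset m → ℕ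
    δ p q = shift k ℓ s t (bottom p) (bottom q)

  lowerBoth : Subset (L + m) → Subset (L + m)
  lowerBoth p = lower (δ p₁ p₂) p₁ ++ lower (t ∸ δ p₁ p₂) p₂
    where p₁ = take L p; p₂ = drop L p

  -- The split is computed anew from the given parts. On a lowered set whose chains allowed all the
  -- steps, the bottoms are the old ones, so it comes out the same.
  raiseBoth : Subset (L + m) → Subset (L + m)
  raiseBoth p = raise (δ p₁ p₂) p₁ ++ raise (t ∸ δ p₁ p₂) p₂
    where p₁ = take L p; p₂ = drop L p

  lowerBoth-⊑ : ∀ p → lowerBoth p ⊑ p
  lowerBoth-⊑ p = subst (lowerBoth p ⊑_) (take++drop≡id L p)
    (++-⊑ (lower-⊆ (δ p₁ p₂) p₁) (lower-⊆ (t ∸ δ p₁ p₂) p₂))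
    where p₁ = take L p; p₂ = drop L p

  module _ (p : Subset (L + m)) (∣p∣≡k+t : ∣ p ∣ ≡ k + t)
           (s<∣p₁∣ : s < ∣ take L p ∣) (∣p₁∣<ℓ : ∣ take L p ∣ < ℓ) where

    private
      p₁ = take L p
      p₂ = drop L p
      d  = δ p₁ p₂

      open Shift ℓ≤k s+m≡k+t
        (∣p∣≡bottom+removable p₁) (∣p∣≡bottom+removable p₂) (∣p∣+bottom≤n p₁) (∣p∣+bottom≤n p₂)
        (trans (∣take∣+∣drop∣ L p) ∣p∣≡k+t) s<∣p₁∣ ∣p₁∣<ℓ

      q₁ = lower d p₁
      q₂ = lower (t ∸ d) p₂

      δ-invariant : δ q₁ q₂ ≡ d
      δ-invariant = cong₂ (shift k ℓ s t) (bottom-lower d p₁ shift≤bx) (bottom-lower (t ∸ d) p₂ t∸shift≤by)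

    ∣lowerBoth∣ : ∣ lowerBoth p ∣ ≡ k
    ∣lowerBoth∣ = +-cancelʳ-≡ t _ _ (begin
      ∣ lowerBoth p ∣ + t              ≡⟨ cong₂ _+_ (∣++∣ q₁ q₂) (sym (m+[n∸m]≡n shift≤t)) ⟩
      ∣ q₁ ∣ + ∣ q₂ ∣ + (d + (t ∸ d))  ≡⟨ interchange ∣ q₁ ∣ ∣ q₂ ∣ d (t ∸ d) ⟩
      ∣ q₁ ∣ + d + (∣ q₂ ∣ + (t ∸ d))  ≡⟨ cong₂ _+_ (∣lower∣ d p₁ shift≤bx) (∣lower∣ (t ∸ d) p₂ t∸shift≤by) ⟩
      ∣ p₁ ∣ + ∣ p₂ ∣                  ≡⟨ ∣take∣+∣drop∣ L p ⟩
      ∣ p ∣                            ≡⟨ ∣p∣≡k+t ⟩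
      k + t                            ∎)
      where
      open ≡-Reasoning
      interchange : ∀ a b c e → a + b + (c + e) ≡ a + c + (b + e)
      interchange = solve-∀

    s<∣take-lowerBoth∣ : s < ∣ take L (lowerBoth p) ∣
    s<∣take-lowerBoth∣ = subst (s <_) (cong ∣_∣ (sym (take-++ q₁ q₂)))
      (+-cancelʳ-< d s _ (subst (s + d <_) (sym (∣lower∣ d p₁ shift≤bx)) s+shift<u))

    raiseBoth-lowerBoth : raiseBoth (lowerBoth p) ≡ p
    raiseBoth-lowerBoth = begin
      raiseBoth (q₁ ++ q₂)                              ≡⟨ cong₂ raiseParts (take-++ q₁ q₂) (drop-++ q₁ q₂) ⟩
      raise (δ q₁ q₂) q₁ ++ raise (t ∸ δ q₁ q₂) q₂      ≡⟨ cong (λ e → raise e q₁ ++ raise (t ∸ e) q₂) δ-invariant ⟩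
      raise d q₁ ++ raise (t ∸ d) q₂                    ≡⟨ cong₂ _++_ (raise-lower d p₁ shift≤bx)
                                                                    (raise-lower (t ∸ d) p₂ t∸shift≤by) ⟩
      p₁ ++ p₂                                          ≡⟨ take++drop≡id L p ⟩
      p                                                 ∎
      where
      open ≡-Reasoning
      -- Each half also occurs inside `δ`; abstracting over both lets one `cong₂` replace them
      -- everywhere.
      raiseParts : Subset L → Subset m → Subset (L + m)
      raiseParts r₁ r₂ = raise (δ r₁ r₂) r₁ ++ raise (t ∸ δ r₁ r₂) r₂

-- Counting the k-sets.

module _ (s k ℓ m t : ℕ) (ℓ≤k : ℓ ≤ k) (s<ℓ : s < ℓ) (k+ℓ+t≡n : k + ℓ + t ≡ ℓ + s + m)
         (F G : Family (ℓ + s + m))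
         (F-size : ∀ {A} → ⟦ F ⟧ A → ∣ A ∣ ≡ k) (G-size : ∀ {A} → ⟦ G ⟧ A → ∣ A ∣ ≡ ℓ)
         (F-meets-G : CrossIntersecting F G)
         (F-high : ∀ {A} → ⟦ F ⟧ A → s < ∣ take (ℓ + s) A ∣)
         (G-high : ∀ {A} → ⟦ G ⟧ A → s < ∣ take (ℓ + s) A ∣) where

  private
    L : ℕ
    L = ℓ + s

    s+m≡k+t : s + m ≡ k + t
    s+m≡k+t = +-cancelˡ-≡ ℓ _ _ (begin
      ℓ + (s + m)  ≡⟨ +-assoc ℓ s m ⟨
      ℓ + s + m    ≡⟨ k+ℓ+t≡n ⟨
      k + ℓ + t    ≡⟨ cong (_+ t) (+-comm k ℓ) ⟩
      ℓ + k + t    ≡⟨ +-assoc ℓ k t ⟩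
      ℓ + (k + t)  ∎)
      where open ≡-Reasoning

    open Matching k ℓ s t m ℓ≤k s+m≡k+t

    sticksOut? : Decidable (λ (A : Subset (L + m)) → ∣ take L A ∣ < ℓ)
    sticksOut? A = ∣ take L A ∣ <? ℓ

    -- As members of G have ℓ elements, those with fewer than ℓ of them in [L] stick out of [L], and
    -- the others lie inside.
    Gᵒ Gⁱ : List (Subset (L + m))
    Gᵒ = filter sticksOut? (members G)
    Gⁱ = filter (∁? sticksOut?) (members G)

    -- All ℓ elements are used up in [L], so none lies beyond it; padding with `⊥` then inverts
    -- `take L`.
    Gⁱ-flat : ∀ {A} → A ∈ Gⁱ → ∣ take L A ∣ ≡ ℓ × take L A ++ ⊥ ≡ A
    Gⁱ-flat {A} A∈ =
      ∣A₁∣≡ℓ , trans (cong (take L A ++_) (sym (∣p∣≡0⇒p≡⊥ _ ∣A₂∣≡0))) (take++drop≡id L A)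
      where
      A∈G∧≮ℓ = ∈-filter⁻ (∁? sticksOut?) {xs = members G} A∈
      ∣A₁∣+∣A₂∣≡ℓ : ∣ take L A ∣ + ∣ drop L A ∣ ≡ ℓ
      ∣A₁∣+∣A₂∣≡ℓ = trans (∣take∣+∣drop∣ L A) (G-size (proj₁ A∈G∧≮ℓ))
      ∣A₁∣≡ℓ : ∣ take L A ∣ ≡ ℓ
      ∣A₁∣≡ℓ = ≤-antisym (m+n≤o⇒m≤o _ (≤-reflexive ∣A₁∣+∣A₂∣≡ℓ)) (≮⇒≥ (proj₂ A∈G∧≮ℓ))
      ∣A₂∣≡0 : ∣ drop L A ∣ ≡ 0
      ∣A₂∣≡0 = +-cancelˡ-≡ ℓ _ _ (trans (cong (_+ ∣ drop L A ∣) (sym ∣A₁∣≡ℓ))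
        (trans ∣A₁∣+∣A₂∣≡ℓ (sym (+-identityʳ ℓ))))

    length-Gⁱ : length Gⁱ ≤ L C ℓ
    length-Gⁱ = subst (_≤ L C ℓ) (length-map (take L) Gⁱ) (length≤nCk ℓ
      (map-unique (take L) (_++ ⊥) (λ A∈ → proj₂ (Gⁱ-flat A∈)) (Unique.filter⁺ (∁? sticksOut?) (unique G)))
      λ p∈ → let _ , A∈ , p≡ = ∈-map⁻ (take L) p∈ in trans (cong ∣_∣ p≡) (proj₁ (Gⁱ-flat A∈)))

    module Mate {A} (A∈ : A ∈ Gᵒ) where
      A∈G : ⟦ G ⟧ A
      A∈G = proj₁ (∈-filter⁻ sticksOut? {xs = members G} A∈)

      A₁<ℓ : ∣ take L A ∣ < ℓ
      A₁<ℓ = proj₂ (∈-filter⁻ sticksOut? {xs = members G} A∈)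

      ∣∁A∣≡k+t : ∣ ∁ A ∣ ≡ k + t
      ∣∁A∣≡k+t = +-cancelˡ-≡ ℓ _ _ (begin
        ℓ + ∣ ∁ A ∣      ≡⟨ cong (_+ ∣ ∁ A ∣) (G-size A∈G) ⟨
        ∣ A ∣ + ∣ ∁ A ∣  ≡⟨ ∣p∣+∣∁p∣≡n A ⟩
        L + m            ≡⟨ +-assoc ℓ s m ⟩
        ℓ + (s + m)      ≡⟨ cong (ℓ +_) s+m≡k+t ⟩
        ℓ + (k + t)      ∎)
        where open ≡-Reasoning

      ∣A₁∣+∣take∁A∣≡L : ∣ take L A ∣ + ∣ take L (∁ A) ∣ ≡ ℓ + s
      ∣A₁∣+∣take∁A∣≡L = trans (cong (λ p → ∣ take L A ∣ + ∣ p ∣) (take-map _ L A)) (∣p∣+∣∁p∣≡n (take L A))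

      -- Complementation inside [L], which has ℓ + s elements, trades a bound below ℓ for one above
      -- s.
      s<∣take∁A∣ : s < ∣ take L (∁ A) ∣
      s<∣take∁A∣ = +-cancelˡ-< ℓ _ _ (subst (_< ℓ + ∣ take L (∁ A) ∣) ∣A₁∣+∣take∁A∣≡L (+-monoˡ-< _ A₁<ℓ))

      -- The same trade backwards; the intersecting property of G enters here, through `G-high`.
      ∣take∁A∣<ℓ : ∣ take L (∁ A) ∣ < ℓ
      ∣take∁A∣<ℓ = +-cancelˡ-< s _ _ (subst (s + ∣ take L (∁ A) ∣ <_)
        (trans ∣A₁∣+∣take∁A∣≡L (+-comm ℓ s)) (+-monoˡ-< _ (G-high A∈G)))

      size-mate : ∣ lowerBoth (∁ A) ∣ ≡ k
      size-mate = ∣lowerBoth∣ (∁ A) ∣∁A∣≡k+t s<∣take∁A∣ ∣take∁A∣<ℓ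

      mate-high : s < ∣ take L (lowerBoth (∁ A)) ∣
      mate-high = s<∣take-lowerBoth∣ (∁ A) ∣∁A∣≡k+t s<∣take∁A∣ ∣take∁A∣<ℓ

      unmate : ∁ (raiseBoth (lowerBoth (∁ A))) ≡ A
      unmate = trans (cong ∁ (raiseBoth-lowerBoth (∁ A) ∣∁A∣≡k+t s<∣take∁A∣ ∣take∁A∣<ℓ)) (∁-involutive A)

    mates low : List (Subset (L + m))
    mates = map (lowerBoth ∘ ∁) Gᵒ
    low   = lowChoices L m k s

    -- A mate lies in the complement of its A, so it fails to meet a member of G.
    F∩mates : Disjoint (members F) mates
    F∩mates (B∈F , B∈) with A , A∈ , refl ← ∈-map⁻ (lowerBoth ∘ ∁) B∈ =
      <⇒≢ (F-meets-G B∈F (Mate.A∈G A∈))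
        (sym (trans (cong ∣_∣ (∩-comm _ A)) (q⊑∁p⇒∣p∩q∣≡0 A (lowerBoth-⊑ (∁ A)))))

    low⇒∣take∣≤s : ∀ {B} → B ∈ low → ∣ take L B ∣ ≤ s
    low⇒∣take∣≤s B∈ with i , i≤s , B∈i ← ∈lowChoices⁻ L m k s B∈ =
      subst (_≤ s) (sym (∈splitChoices⇒∣take∣≡ L m k i B∈i)) i≤s

    mates∩low : Disjoint mates low
    mates∩low (B∈ , B∈low) with A , A∈ , refl ← ∈-map⁻ (lowerBoth ∘ ∁) B∈ =
      <⇒≱ (Mate.mate-high A∈) (low⇒∣take∣≤s B∈low)

    F∩rest : Disjoint (members F) (mates List.++ low)
    F∩rest (B∈F , B∈) = [ (λ B∈mates → F∩mates (B∈F , B∈mates))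
                        , (λ B∈low → <⇒≱ (F-high B∈F) (low⇒∣take∣≤s B∈low)) ]′ (∈-++⁻ mates B∈)

    all-size-k : ∀ {B} → B ∈ members F List.++ mates List.++ low → ∣ B ∣ ≡ k
    all-size-k B∈ with ∈-++⁻ (members F) B∈
    ... | inj₁ B∈F = F-size B∈F
    ... | inj₂ B∈′ with ∈-++⁻ mates B∈′
    ...   | inj₁ B∈mates with A , A∈ , refl ← ∈-map⁻ (lowerBoth ∘ ∁) B∈mates = Mate.size-mate A∈
    ...   | inj₂ B∈low with i , i≤s , B∈i ← ∈lowChoices⁻ L m k s B∈low =
      -- Since i ≤ s < ℓ ≤ k, the truncated k ∸ i is the true difference.
      ∈splitChoices⇒∣p∣≡k L m k i (≤-trans i≤s (≤-trans (<⇒≤ s<ℓ) ℓ≤k)) B∈i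

    -- The members of F, the mates and the low sets are pairwise disjoint lists of k-sets, and `Gᵒ`
    -- has as many members as there are mates.
    count-k-sets : size F + (length Gᵒ + length low) ≤ (L + m) C k
    count-k-sets = begin
      size F + (length Gᵒ + length low)       ≡⟨ cong (λ l → size F + (l + length low)) (length-map _ Gᵒ) ⟨
      size F + (length mates + length low)    ≡⟨ cong (size F +_) (length-++ mates) ⟨
      size F + length (mates List.++ low)     ≡⟨ length-++ (members F) ⟨
      length (members F List.++ mates List.++ low) ≤⟨ length≤nCk k
        (Unique.++⁺ (unique F) (Unique.++⁺
          (map-unique (lowerBoth ∘ ∁) (∁ ∘ raiseBoth) Mate.unmate (Unique.filter⁺ sticksOut? (unique G)))
          (lowChoices-unique L m k s) mates∩low) F∩rest)
        all-size-k ⟩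
      (L + m) C k                             ∎
      where open ≤-Reasoning

  -- The sum stands on the left to keep the count free of truncated subtraction.
  size-sum-bound : size F + size G + ∑[0‥ s ] (λ i → ((ℓ + s) C i) * (m C (k ∸ i)))
                   ≤ ((ℓ + s) C ℓ) + ((ℓ + s + m) C k)
  size-sum-bound = begin
    size F + size G + _
      ≡⟨ cong₂ (λ g l → size F + g + l) (length-filter+∁ sticksOut? (members G)) (length-lowChoices L m k s) ⟨
    size F + (length Gᵒ + length Gⁱ) + length low
      ≡⟨ rearrange (size F) (length Gᵒ) (length Gⁱ) (length low) ⟩
    length Gⁱ + (size F + (length Gᵒ + length low))
      ≤⟨ +-mono-≤ length-Gⁱ count-k-sets ⟩
    (L C ℓ) + ((L + m) C k)
      ∎
    where
    open ≤-Reasoning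
    rearrange : ∀ f o i l → f + (o + i) + l ≡ i + (f + (o + l))
    rearrange = solve-∀

-- The inequality over the integers.

open import Data.Integer.Base as ℤ using (+_)
import Data.Integer.Properties as ℤ

m+o≤n⇒+m≤+n-+o : ∀ {m n o} → m + o ≤ n → + m ℤ.≤ + n ℤ.- + o
m+o≤n⇒+m≤+n-+o {m} {n} {o} m+o≤n = begin
  + m                      ≡⟨ ℤ.+-identityʳ (+ m) ⟨
  + m ℤ.+ ℤ.0ℤ             ≡⟨ cong (ℤ._+_ (+ m)) (ℤ.+-inverseʳ (+ o)) ⟨
  + m ℤ.+ (+ o ℤ.- + o)    ≡⟨ ℤ.+-assoc (+ m) (+ o) (ℤ.- + o) ⟨
  + (m + o) ℤ.- + o        ≤⟨ ℤ.+-monoˡ-≤ (ℤ.- + o) (ℤ.+≤+ m+o≤n) ⟩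
  + n ℤ.- + o              ∎
  where open ℤ.≤-Reasoning

theorem2p2 : (s k ℓ n : ℕ) → ℓ ≤ k → s + 1 ≤ ℓ → k + ℓ ≤ n →
    (F G : Family n) →
    ⟦ F ⟧ ⊆ (⊤ choose k) →
    ⟦ G ⟧ ⊆ (⊤ choose ℓ) →
    CrossIntersecting F G →
    Intersecting G →
    (segment n (ℓ + s) choose ℓ) ⊆ ⟦ G ⟧ →
    + (size F + size G)
    ℤ.≤ + ((ℓ + s) C ℓ) ℤ.+ + (n C k)
    ℤ.- + (∑[0‥ s ] (λ i → ((ℓ + s) C i) * ((n ∸ ℓ ∸ s) C (k ∸ i))))
theorem2p2 s k ℓ n ℓ≤k s+1≤ℓ k+ℓ≤n F G F⊆ G⊆ F-meets-G G-meets-G seg⊆G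
  with s<ℓ ← subst (_≤ ℓ) (+-comm s 1) s+1≤ℓ
  -- From ℓ + s ≤ ℓ + k ≤ n, the ground set splits into its first ℓ + s elements and m others.
  with m , refl ← m≤n⇒∃[o]m+o≡n (≤-trans (+-monoʳ-≤ ℓ (≤-trans (<⇒≤ s<ℓ) ℓ≤k))
                                               (subst (_≤ n) (+-comm k ℓ) k+ℓ≤n))
  with t , k+ℓ+t≡n ← m≤n⇒∃[o]m+o≡n k+ℓ≤n
  -- This turns n ∸ ℓ ∸ s into m.
  rewrite ∸-+-assoc (ℓ + s + m) ℓ s | m+n∸m≡n (ℓ + s) m =
  m+o≤n⇒+m≤+n-+o (size-sum-bound s k ℓ m t ℓ≤k s<ℓ k+ℓ+t≡n F G (proj₂ ∘ F⊆) (proj₂ ∘ G⊆) F-meets-G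
    -- Members of F meet the ℓ-subsets of [ℓ + s] by cross-intersection, members of G because G is
    -- intersecting.
    (λ {A} A∈ → meets-all⇒s<∣take∣ ℓ s A (λ q∈ → F-meets-G A∈ (seg⊆G q∈)))
    (λ {A} A∈ → meets-all⇒s<∣take∣ ℓ s A (λ q∈ → G-meets-G A∈ (seg⊆G q∈))))
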